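{- Let $\mathcal{A}=(A,0^\mathcal{A},1^\mathcal{A},\land^\mathcal{A},\lor^\mathcal{A},\to^\mathcal{A})$ be an algebraic interpretation. (1) If $\mathcal{A}$ is consistent with $\vdash_\mathsf{IPC}$, then $\mathcal{A}$ is a Heyting algebra. (2) If $\mathcal{A}$ is consistent with $\vdash_\mathsf{CPC}$, then, defining $a'=a\to^\mathcal{A}0^\mathcal{A}$, the structure $(A,0^\mathcal{A},1^\mathcal{A},\land^\mathcal{A},\lor^\mathcal{A},')$ is a Boolean algebra.
   Context: The language is generated from a countably infinite set $\mathit{Prop}$ of variables by $\bot,\top,\land,\lor,\to$; $\vdash_\mathsf{IPC}$ and $\vdash_\mathsf{CPC}$ are the intuitionistic and classical propositional consequence relations. An algebraic interpretation is any structure $\mathcal{A}=(A,0^\mathcal{A},1^\mathcal{A},\land^\mathcal{A},\lor^\mathcal{A},\to^\mathcal{A})$ (two constants, three binary operations) such that the relation $a\leq^\mathcal{A}b\iff a\land^\mathcal{A}b=a$ is a partial order on $A$ having $1^\mathcal{A}$ as largest element; no other conditions are imposed. A valuation is a map $v:\mathit{Prop}\to A$, and $[\![\varphi]\!]_v$ is the value of $\varphi$ under the unique homomorphic extension of $v$ ($\bot\mapsto0^\mathcal{A}$, $\top\mapsto1^\mathcal{A}$, connectives to the corresponding operations). $\mathcal{A}$ is consistent with $\vdash$ if whenever $\psi_1,\ldots,\psi_n\vdash\varphi$, for every valuation $v$ and every $c\in A$, if $c\leq^\mathcal{A}[\![\psi_i]\!]_v$ for all $i=1,\ldots,n$ then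 $c\leq^\mathcal{A}[\![\varphi]\!]_v$ (for $n=0$ this means $[\![\varphi]\!]_v=1^\mathcal{A}$). -}

module Defs where

open import Data.Empty using () renaming (⊥ to Empty)
open import Data.List.Base using (List; _∷_)
open import Data.List.Membership.Propositional using (_∈_)
open import Data.List.Relation.Unary.All using (All)
open import Data.Nat.Base using (ℕ)
open import Level using (Level; suc)
open import Relation.Binary.Core using (Rel)
open import Relation.Binary.Definitions using (Maximum)
open import Relation.Binary.PropositionalEquality using (_≡_)
open import Relation.Binary.Structures using (IsPartialOrder)

infixr 7 _∧_
infixr 6 _∨_
infixr 5 _⇒_
infix  8 ¬_

data Formula : Set where
  var         : ℕ → Formula
  ⊥ ⊤         : Formula
  _∧_ _∨_ _⇒_ : Formula → Formula → Formula

¬_ : Formula → Formula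
¬ φ = φ ⇒ ⊥

-- Natural deduction for intuitionistic logic, extended by the axioms Ax.
data Derivable (Ax : Formula → Set) (Γ : List Formula) : Formula → Set where
  axiom : ∀ {φ} → Ax φ → Derivable Ax Γ φ
  hyp   : ∀ {φ} → φ ∈ Γ → Derivable Ax Γ φ
  ⊤I    : Derivable Ax Γ ⊤
  ⊥E    : ∀ {φ} → Derivable Ax Γ ⊥ → Derivable Ax Γ φ
  ∧I    : ∀ {φ ψ} → Derivable Ax Γ φ → Derivable Ax Γ ψ → Derivable Ax Γ (φ ∧ ψ)
  ∧E₁   : ∀ {φ ψ} → Derivable Ax Γ (φ ∧ ψ) → Derivable Ax Γ φ
  ∧E₂   : ∀ {φ ψ} → Derivable Ax Γ (φ ∧ ψ) → Derivable Ax Γ ψ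
  ∨I₁   : ∀ {φ ψ} → Derivable Ax Γ φ → Derivable Ax Γ (φ ∨ ψ)
  ∨I₂   : ∀ {φ ψ} → Derivable Ax Γ ψ → Derivable Ax Γ (φ ∨ ψ)
  ∨E    : ∀ {φ ψ χ} → Derivable Ax Γ (φ ∨ ψ) →
          Derivable Ax (φ ∷ Γ) χ → Derivable Ax (ψ ∷ Γ) χ → Derivable Ax Γ χ
  ⇒I    : ∀ {φ ψ} → Derivable Ax (φ ∷ Γ) ψ → Derivable Ax Γ (φ ⇒ ψ)
  ⇒E    : ∀ {φ ψ} → Derivable Ax Γ (φ ⇒ ψ) → Derivable Ax Γ φ → Derivable Ax Γ ψ

data ExcludedMiddle : Formula → Set where
  lem : ∀ φ → ExcludedMiddle (φ ∨ ¬ φ)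

ConsequenceRelation : Set₁
ConsequenceRelation = List Formula → Formula → Set

infix 3 _⊢IPC_ _⊢CPC_

_⊢IPC_ : ConsequenceRelation
_⊢IPC_ = Derivable (λ _ → Empty)

_⊢CPC_ : ConsequenceRelation
_⊢CPC_ = Derivable ExcludedMiddle

record AlgebraicInterpretation (a : Level) : Set (suc a) where
  infixr 7 _∧ᴬ_
  infixr 6 _∨ᴬ_
  infixr 5 _→ᴬ_
  infix  4 _≤ᴬ_

  field
    Carrier : Set a
    0ᴬ 1ᴬ   : Carrier
    _∧ᴬ_    : Carrier → Carrier → Carrier
    _∨ᴬ_    : Carrier → Carrier → Carrier
    _→ᴬ_    : Carrier → Carrier → Carrier

  _≤ᴬ_ : Rel Carrier a
  x ≤ᴬ y = (x ∧ᴬ y) ≡ x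

  field
    isPartialOrder : IsPartialOrder _≡_ _≤ᴬ_
    maximum        : Maximum _≤ᴬ_ 1ᴬ

  Valuation : Set a
  Valuation = ℕ → Carrier

  ⟦_⟧ : Formula → Valuation → Carrier
  ⟦ var p ⟧ v = v p
  ⟦ ⊥ ⟧     v = 0ᴬ
  ⟦ ⊤ ⟧     v = 1ᴬ
  ⟦ φ ∧ ψ ⟧ v = ⟦ φ ⟧ v ∧ᴬ ⟦ ψ ⟧ v
  ⟦ φ ∨ ψ ⟧ v = ⟦ φ ⟧ v ∨ᴬ ⟦ ψ ⟧ v
  ⟦ φ ⇒ ψ ⟧ v = ⟦ φ ⟧ v →ᴬ ⟦ ψ ⟧ v

  -- When Γ is empty, c ranges over the whole carrier, so ⟦ φ ⟧ v is the
  -- largest element 1ᴬ.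
  ConsistentWith : ConsequenceRelation → Set a
  ConsistentWith _⊢_ = ∀ {Γ φ} → Γ ⊢ φ → ∀ (v : Valuation) (c : Carrier) →
    All (λ ψ → c ≤ᴬ ⟦ ψ ⟧ v) Γ → c ≤ᴬ ⟦ φ ⟧ v

{-# OPTIONS --safe #-}
module Submission where

-- Consistency only transfers derivations from a list of premises, whereas the
-- universal properties of ∨ and → have inequalities in the algebra as
-- hypotheses.  Since x ≤ z is by definition the equation x ∧ z = x, such a
-- hypothesis can be built into a formula: if x ≤ z and y ≤ z, then
-- x ∨ y = (x ∧ z) ∨ (y ∧ z) ≤ z because (p ∧ r) ∨ (q ∧ r) ⊢ r.  Likewise,
-- w ∧ x ≤ y gives w ≤ x → (w ∧ x) = x → ((w ∧ x) ∧ y) ≤ x → y.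

open import Defs
open import Algebra.Lattice.Structures using (IsBooleanAlgebra)
open import Algebra.Lattice.Structures.Biased using (isBooleanAlgebraʳ)
open import Data.List.Base using ([]; _∷_)
open import Data.List.Relation.Unary.All using ([]; _∷_)
open import Data.List.Relation.Unary.Any using (here; there)
open import Data.Nat.Base using (zero; suc)
open import Data.Product.Base using (_×_; _,_)
open import Relation.Binary.Lattice.Bundles using (HeytingAlgebra)
open import Relation.Binary.Lattice.Properties.HeytingAlgebra
  using (distributiveLattice)
open import Relation.Binary.Lattice.Structures using (IsHeytingAlgebra)
import Relation.Binary.Lattice.Properties.DistributiveLattice as DistributiveLatticeProperties
import Relation.Binary.Lattice.Properties.Lattice as LatticeProperties
open import Relation.Binary.PropositionalEquality using (_≡_; cong; cong₂; subst; sym)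
open import Relation.Binary.Structures using (IsPartialOrder)

Derivable-mono : ∀ {Ax Ax′ : Formula → Set} → (∀ {φ} → Ax φ → Ax′ φ) →
  ∀ {Γ φ} → Derivable Ax Γ φ → Derivable Ax′ Γ φ
Derivable-mono f (axiom x)  = axiom (f x)
Derivable-mono f (hyp x)    = hyp x
Derivable-mono f ⊤I         = ⊤I
Derivable-mono f (⊥E d)     = ⊥E (Derivable-mono f d)
Derivable-mono f (∧I d e)   = ∧I (Derivable-mono f d) (Derivable-mono f e)
Derivable-mono f (∧E₁ d)    = ∧E₁ (Derivable-mono f d)
Derivable-mono f (∧E₂ d)    = ∧E₂ (Derivable-mono f d)
Derivable-mono f (∨I₁ d)    = ∨I₁ (Derivable-mono f d)
Derivable-mono f (∨I₂ d)    = ∨I₂ (Derivable-mono f d)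
Derivable-mono f (∨E d e g) = ∨E (Derivable-mono f d) (Derivable-mono f e) (Derivable-mono f g)
Derivable-mono f (⇒I d)     = ⇒I (Derivable-mono f d)
Derivable-mono f (⇒E d e)   = ⇒E (Derivable-mono f d) (Derivable-mono f e)

⊢CPC-of-⊢IPC : ∀ {Γ φ} → Γ ⊢IPC φ → Γ ⊢CPC φ
⊢CPC-of-⊢IPC = Derivable-mono λ ()

private
  hyp₀ : ∀ {Ax Γ φ} → Derivable Ax (φ ∷ Γ) φ
  hyp₀ = hyp (here _≡_.refl)

  hyp₁ : ∀ {Ax Γ φ ψ} → Derivable Ax (ψ ∷ φ ∷ Γ) φ
  hyp₁ = hyp (there (here _≡_.refl))

  p q r : Formula
  p = var 0
  q = var 1
  r = var 2

module _ {a} (𝒜 : AlgebraicInterpretation a) where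
  open AlgebraicInterpretation 𝒜
  open IsPartialOrder isPartialOrder using (refl; trans; antisym)

  private
    -- The formulas evaluated below contain only `p`, `q` and `r`, so `z` serves as the default
    -- value at every later index. When fewer than three elements are involved, the last one is
    -- repeated.
    valuation : Carrier → Carrier → Carrier → Valuation
    valuation x y z zero          = x
    valuation x y z (suc zero)    = y
    valuation x y z (suc (suc _)) = z

  module _ (consistent : ConsistentWith _⊢IPC_) where

    -- With a single premise, the bound `c` can be the value of that premise, where the required
    -- inequality is reflexivity.
    entails : ∀ {φ ψ} → φ ∷ [] ⊢IPC ψ → ∀ v → ⟦ φ ⟧ v ≤ᴬ ⟦ ψ ⟧ v
    entails d v = consistent d v _ (refl ∷ [])

    0ᴬ-minimum : ∀ x → 0ᴬ ≤ᴬ x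
    0ᴬ-minimum x = entails {⊥} {p} (⊥E hyp₀) (valuation x x x)

    x∧y≤x : ∀ x y → x ∧ᴬ y ≤ᴬ x
    x∧y≤x x y = entails {p ∧ q} {p} (∧E₁ hyp₀) (valuation x y y)

    x∧y≤y : ∀ x y → x ∧ᴬ y ≤ᴬ y
    x∧y≤y x y = entails {p ∧ q} {q} (∧E₂ hyp₀) (valuation x y y)

    ∧-greatest : ∀ {x y z} → z ≤ᴬ x → z ≤ᴬ y → z ≤ᴬ x ∧ᴬ y
    ∧-greatest {x} {y} {z} z≤x z≤y =
      -- The bound `c` is now the arbitrary element `z`, and the two hypotheses say that it lies
      -- below both premises.
      consistent {p ∷ q ∷ []} {p ∧ q}
        (∧I hyp₀ hyp₁)
        (valuation x y y) z (z≤x ∷ z≤y ∷ [])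

    x≤x∨y : ∀ x y → x ≤ᴬ x ∨ᴬ y
    x≤x∨y x y = entails {p} {p ∨ q} (∨I₁ hyp₀) (valuation x y y)

    y≤x∨y : ∀ x y → y ≤ᴬ x ∨ᴬ y
    y≤x∨y x y = entails {q} {p ∨ q} (∨I₂ hyp₀) (valuation x y y)

    ∨-least : ∀ {x y z} → x ≤ᴬ z → y ≤ᴬ z → x ∨ᴬ y ≤ᴬ z
    ∨-least {x} {y} {z} x≤z y≤z =
      subst (_≤ᴬ z) (cong₂ _∨ᴬ_ x≤z y≤z)
        (entails {(p ∧ r) ∨ (q ∧ r)} {r}
          (∨E hyp₀ (∧E₂ hyp₀) (∧E₂ hyp₀))
          (valuation x y z))

    transpose-→ : ∀ {w x y} → w ∧ᴬ x ≤ᴬ y → w ≤ᴬ x →ᴬ y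
    transpose-→ {w} {x} {y} w∧x≤y = trans
      -- Monotonicity of `→ᴬ` in its second argument is not yet available, so the consequent is
      -- rewritten along the equation that `w∧x≤y` stands for.
      (subst (λ u → w ≤ᴬ x →ᴬ u) (sym w∧x≤y)
        (entails {p} {q ⇒ (p ∧ q)}
          (⇒I (∧I hyp₁ hyp₀)) v))
      (entails {q ⇒ ((p ∧ q) ∧ r)} {q ⇒ r}
        (⇒I (∧E₂ (⇒E hyp₁ hyp₀))) v)
      where v = valuation w x y

    modus-ponens : ∀ x y → (x →ᴬ y) ∧ᴬ x ≤ᴬ y
    modus-ponens x y = entails {(p ⇒ q) ∧ p} {q}
      (⇒E (∧E₁ hyp₀) (∧E₂ hyp₀)) (valuation x y y)

    -- Here the hypothesis enters by transitivity: `w ∧ᴬ x` is below both `x →ᴬ y` and `x`, hence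
    -- below their meet.
    transpose-∧ : ∀ {w x y} → w ≤ᴬ x →ᴬ y → w ∧ᴬ x ≤ᴬ y
    transpose-∧ {w} {x} {y} w≤x→y = trans
      (∧-greatest (trans (x∧y≤x w x) w≤x→y) (x∧y≤y w x)) (modus-ponens x y)

    isHeytingAlgebra : IsHeytingAlgebra _≡_ _≤ᴬ_ _∨ᴬ_ _∧ᴬ_ _→ᴬ_ 1ᴬ 0ᴬ
    isHeytingAlgebra = record
      { isBoundedLattice = record
        { isLattice = record
          { isPartialOrder = isPartialOrder
          ; supremum       = λ x y → x≤x∨y x y , y≤x∨y x y , λ _ → ∨-least
          ; infimum        = λ x y → x∧y≤x x y , x∧y≤y x y , λ _ → ∧-greatest
          }
        ; maximum   = maximum
        ; minimum   = 0ᴬ-minimum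
        }
      ; exponential      = λ _ _ _ → transpose-→ , transpose-∧
      }

    heytingAlgebra : HeytingAlgebra a a a
    heytingAlgebra = record { isHeytingAlgebra = isHeytingAlgebra }

  module _ (consistent : ConsistentWith _⊢CPC_) where

    consistentIPC : ConsistentWith _⊢IPC_
    consistentIPC d = consistent (⊢CPC-of-⊢IPC d)

    ∨-complementʳ : ∀ x → x ∨ᴬ (x →ᴬ 0ᴬ) ≡ 1ᴬ
    ∨-complementʳ x = antisym (maximum _)
      -- With no premises every `c` is admissible, in particular the top element.
      (consistent {[]} (axiom (lem p)) (valuation x x x) 1ᴬ [])

    ∧-complementʳ : ∀ x → x ∧ᴬ (x →ᴬ 0ᴬ) ≡ 0ᴬ
    ∧-complementʳ x = antisym
      (entails consistentIPC {p ∧ ¬ p} {⊥}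
        (⇒E (∧E₂ hyp₀) (∧E₁ hyp₀)) (valuation x x x))
      (0ᴬ-minimum consistentIPC _)

    isBooleanAlgebra : IsBooleanAlgebra _≡_ _∨ᴬ_ _∧ᴬ_ (λ x → x →ᴬ 0ᴬ) 1ᴬ 0ᴬ
    -- Distributivity is inherited from the Heyting algebra; the left complement laws follow from
    -- the right ones by commutativity.
    isBooleanAlgebra = isBooleanAlgebraʳ record
      { isDistributiveLattice = record
        { isLattice           = LatticeProperties.isAlgLattice (HeytingAlgebra.lattice H)
        ; ∨-distrib-∧         = DistributiveLatticeProperties.∨-distrib-∧ (distributiveLattice H)
        ; ∧-distrib-∨         = DistributiveLatticeProperties.∧-distrib-∨ (distributiveLattice H)
        }
      ; ∨-complementʳ         = ∨-complementʳ
      ; ∧-complementʳ         = ∧-complementʳ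
      ; ¬-cong                = cong (_→ᴬ 0ᴬ)
      }
      where H = heytingAlgebra consistentIPC

theorem3 : ∀ {a} (𝒜 : AlgebraicInterpretation a) →
    let open AlgebraicInterpretation 𝒜 in
    (ConsistentWith _⊢IPC_ → IsHeytingAlgebra _≡_ _≤ᴬ_ _∨ᴬ_ _∧ᴬ_ _→ᴬ_ 1ᴬ 0ᴬ) ×
    (ConsistentWith _⊢CPC_ → IsBooleanAlgebra _≡_ _∨ᴬ_ _∧ᴬ_ (λ x → x →ᴬ 0ᴬ) 1ᴬ 0ᴬ)
theorem3 𝒜 = isHeytingAlgebra 𝒜 , isBooleanAlgebra 𝒜
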